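{- A finite skew brace $A$ has $\Lambda(A)$ with exactly one vertex if and only if $A$ is isomorphic to a skew brace on a set $F\times\mathbb{Z}/2\mathbb{Z}$ with operations \[(f_1,k_1)+(f_2,k_2)=\big(f_1+(-1)^{k_1}f_2+k_1k_2y,\,k_1+k_2\big),\] \[(f_1,k_1)\circ(f_2,k_2)=\big(f_1+(-1)^{k_1}f_2+\psi(f_1,k_1,k_2)+k_1k_2y,\,k_1+k_2\big),\] where $F\neq\{0\}$ is a finite abelian group, $y\in F$ satisfies $2y=0$, and $\psi\colon F\times\mathbb{Z}/2\mathbb{Z}\times\mathbb{Z}/2\mathbb{Z}\to F$ is a surjective map of the form \[\psi(f,k_1,k_2)=[k_2]\big(\phi(f)-[k_1]z\big),\] with $\phi\in\operatorname{End}(F)$ and $z\in F$ satisfying $\phi(z)=\phi(y)-2z$ and $\phi(\phi(f))=-2\phi(f)$ for all $f\in F$.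
   Context: A skew brace is a triple $(A,+,\circ)$ where $(A,+)$ and $(A,\circ)$ are groups with $a\circ(b+c)=a\circ b-a+a\circ c$. $\lambda_a(b)=-a+a\circ b$ defines an action of $(A,\circ)$ on $(A,+)$ by automorphisms. $\Lambda(A)$ is the graph whose vertices are the $\lambda$-orbits of size $>1$, two distinct vertices $L_1,L_2$ adjacent iff $\gcd(|L_1|,|L_2|)\ne1$. For $k\in\mathbb{Z}/2\mathbb{Z}$, $[k]\in\{0,1\}$ denotes its representative (equivalently $[k]=\frac{1-(-1)^k}{2}$); products such as $k_1k_2y$ mean $[k_1][k_2]y$ and $(-1)^k$ is computed with any representative. -}

module Defs where

open import Level using (Level; _⊔_; 0ℓ; suc)
open import Algebra.Bundles using (Group; AbelianGroup)
open import Algebra.Structures using (IsGroup)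
open import Algebra.Morphism.Structures using (IsGroupHomomorphism; IsGroupIsomorphism)
import Algebra.Definitions.RawMonoid as Multiples
open import Data.Fin.Base using (Fin)
open import Data.Fin.Subset using (Subset; _∈_; ∣_∣)
open import Data.Nat.Base as ℕ using (ℕ; _<_)
open import Data.Nat.GCD using (gcd; gcd-comm)
open import Data.Parity.Base as ℙ using (Parity; 0ℙ; 1ℙ)
open import Data.Product.Base using (_×_; _,_; ∃-syntax; proj₁; proj₂)
open import Data.Product.Relation.Binary.Pointwise.NonDependent using (_×ₛ_)
open import Function.Base using (_∘′_)
open import Function.Bundles using (Inverse; _⇔_)
open import Function.Definitions using (Surjective)
open import Relation.Binary.Bundles using (Setoid)
open import Relation.Binary.Core using (Rel)
open import Relation.Binary.Definitions using (Symmetric)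
import Relation.Binary.Construct.On as On
open import Relation.Binary.PropositionalEquality as ≡ using (_≡_; _≢_)
open import Relation.Nullary.Negation using (¬_)

Finite : ∀ {c ℓ} → Setoid c ℓ → Set (c ⊔ ℓ)
Finite S = ∃[ n ] Inverse S (≡.setoid (Fin n))

record IsSkewBrace {c ℓ} {A : Set c} (_≈_ : Rel A ℓ)
                   (_+_ : A → A → A) (0# : A) (-_ : A → A)
                   (_∘_ : A → A → A) (1# : A) (_⁻¹ : A → A) : Set (c ⊔ ℓ) where
  field
    +-isGroup : IsGroup _≈_ _+_ 0# -_
    ∘-isGroup : IsGroup _≈_ _∘_ 1# _⁻¹
    distrib   : ∀ a b c → (a ∘ (b + c)) ≈ (((a ∘ b) + (- a)) + (a ∘ c))

record SkewBrace c ℓ : Set (suc (c ⊔ ℓ)) where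
  infix  8 -_
  infixl 7 _∘_
  infixl 6 _+_
  infix  4 _≈_
  field
    Carrier     : Set c
    _≈_         : Rel Carrier ℓ
    _+_         : Carrier → Carrier → Carrier
    0#          : Carrier
    -_          : Carrier → Carrier
    _∘_         : Carrier → Carrier → Carrier
    1#          : Carrier
    _⁻¹         : Carrier → Carrier
    isSkewBrace : IsSkewBrace _≈_ _+_ 0# -_ _∘_ 1# _⁻¹

  open IsSkewBrace isSkewBrace public

  +-group : Group c ℓ
  +-group = record { isGroup = +-isGroup }

  ∘-group : Group c ℓ
  ∘-group = record { isGroup = ∘-isGroup }

  setoid : Setoid c ℓ
  setoid = Group.setoid +-group

  -- λ_a(b)
  act : Carrier → Carrier → Carrier
  act a b = - a + a ∘ b

infix 4 _≅_

record _≅_ {c₁ ℓ₁ c₂ ℓ₂} (A : SkewBrace c₁ ℓ₁) (B : SkewBrace c₂ ℓ₂) :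
           Set (c₁ ⊔ ℓ₁ ⊔ c₂ ⊔ ℓ₂) where
  private
    module A = SkewBrace A
    module B = SkewBrace B
  field
    ⟦_⟧    : A.Carrier → B.Carrier
    +-isIso : IsGroupIsomorphism (Group.rawGroup A.+-group) (Group.rawGroup B.+-group) ⟦_⟧
    ∘-isIso : IsGroupIsomorphism (Group.rawGroup A.∘-group) (Group.rawGroup B.∘-group) ⟦_⟧

-- Vertices form a setoid, so counting them is up to its equality.
record Graph v ℓ e : Set (suc (v ⊔ ℓ ⊔ e)) where
  field
    vertices : Setoid v ℓ
  open Setoid vertices public using () renaming (Carrier to Vertex; _≈_ to _≈ᵥ_)
  field
    Adjacent : Rel Vertex e
    symmetric : Symmetric Adjacent
    irreflexive : ∀ {u v} → u ≈ᵥ v → ¬ Adjacent u v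

HasExactlyOneVertex : ∀ {v ℓ e} → Graph v ℓ e → Set (v ⊔ ℓ)
HasExactlyOneVertex G = ∃[ v ] (∀ w → v ≈ᵥ w)
  where open Graph G

-- Subsets of A are encoded as subsets of Fin n along the enumeration of A; in
-- this way an orbit is a subset with a cardinality, and equality of orbits is _≡_.
module _ {c ℓ} (A : SkewBrace c ℓ) (finite : Finite (SkewBrace.setoid A)) where
  open SkewBrace A
  open Inverse (proj₂ finite) using (from)

  IsOrbit : Subset (proj₁ finite) → Set (c ⊔ ℓ)
  IsOrbit L = ∃[ b ] (∀ i → i ∈ L ⇔ (∃[ a ] from i ≈ act a b))

  IsVertex : Subset (proj₁ finite) → Set (c ⊔ ℓ)
  IsVertex L = IsOrbit L × 1 < ∣ L ∣

  Λ : Graph (c ⊔ ℓ) 0ℓ 0ℓ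
  Λ = record
    { vertices    = On.setoid (≡.setoid (Subset (proj₁ finite))) (proj₁ {B = IsVertex})
    ; Adjacent    = λ (L₁ , _) (L₂ , _) → L₁ ≢ L₂ × gcd ∣ L₁ ∣ ∣ L₂ ∣ ≢ 1
    ; symmetric   = λ { {L₁ , _} {L₂ , _} (L₁≢L₂ , gcd≢1) →
                        L₁≢L₂ ∘′ ≡.sym , gcd≢1 ∘′ ≡.trans (gcd-comm ∣ L₁ ∣ ∣ L₂ ∣) }
    ; irreflexive = λ L₁≡L₂ (L₁≢L₂ , _) → L₁≢L₂ L₁≡L₂
    }

-- The representative [k] ∈ {0,1}; Parity plays the role of ℤ/2ℤ.
[_] : Parity → ℕ
[ 0ℙ ] = 0
[ 1ℙ ] = 1

-- The operations on F × ℤ/2ℤ, for an abelian group F written additively.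
module Model {c ℓ} (F : AbelianGroup c ℓ) where
  open Group (AbelianGroup.group F) public using (Carrier; _≈_; setoid; rawGroup)
    renaming (_∙_ to _+_; ε to 0#; _⁻¹ to -_; _//_ to _-_)
  open Multiples (AbelianGroup.rawMonoid F) public using () renaming (_×_ to _·_)

  -- (-1)^k f
  signed : Parity → Carrier → Carrier
  signed 0ℙ f = f
  signed 1ℙ f = - f

  pairs : Setoid c ℓ
  pairs = setoid ×ₛ ≡.setoid Parity

  ψ : (φ : Carrier → Carrier) (z : Carrier) → Carrier → Parity → Parity → Carrier
  ψ φ z f k₁ k₂ = [ k₂ ] · (φ f - ([ k₁ ] · z))

  IsSurjectiveψ : (φ : Carrier → Carrier) (z : Carrier) → Set (c ⊔ ℓ)
  IsSurjectiveψ φ z =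
    Surjective (Setoid._≈_ (setoid ×ₛ (≡.setoid Parity ×ₛ ≡.setoid Parity))) _≈_
      (λ (f , k₁ , k₂) → ψ φ z f k₁ k₂)

  add : (y : Carrier) → Carrier × Parity → Carrier × Parity → Carrier × Parity
  add y (f₁ , k₁) (f₂ , k₂) =
    (f₁ + signed k₁ f₂) + (([ k₁ ] ℕ.* [ k₂ ]) · y) , k₁ ℙ.+ k₂

  mul : (y : Carrier) (φ : Carrier → Carrier) (z : Carrier) →
        Carrier × Parity → Carrier × Parity → Carrier × Parity
  mul y φ z (f₁ , k₁) (f₂ , k₂) =
    ((f₁ + signed k₁ f₂) + ψ φ z f₁ k₁ k₂) + (([ k₁ ] ℕ.* [ k₂ ]) · y) , k₁ ℙ.+ k₂

  -- The data (y, φ, z) together with a skew brace on F × ℤ/2ℤ having these operations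
  -- (whose neutral elements and inverses are determined by the operations).
  record ModelSkewBrace : Set (c ⊔ ℓ) where
    field
      y            : Carrier
      φ            : Carrier → Carrier
      z            : Carrier
      2y≈0         : (2 · y) ≈ 0#
      φ-isEndo     : IsGroupHomomorphism rawGroup rawGroup φ
      φz≈φy-2z     : φ z ≈ (φ y - (2 · z))
      φφ≈-2φ       : ∀ f → φ (φ f) ≈ (- (2 · φ f))
      ψ-surjective : IsSurjectiveψ φ z
      zero         : Carrier × Parity
      neg          : Carrier × Parity → Carrier × Parity
      one          : Carrier × Parity
      inv          : Carrier × Parity → Carrier × Parity
      isSkewBrace  : IsSkewBrace (Setoid._≈_ pairs) (add y) zero neg (mul y φ z) one inv

    skewBrace : SkewBrace c ℓ
    skewBrace = record { isSkewBrace = isSkewBrace }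

{-# OPTIONS --safe #-}

-- Let L be the only nontrivial λ-orbit, x ∈ L, and let Fix be the subgroup of λ-fixed
-- points, so that A is the disjoint union of Fix and L. The stabiliser of x is nontrivial,
-- hence 2|L| ≤ |A| = |Fix| + |L|, which forces Fix to have index two and L = Fix + x.
-- Since y = x + x is fixed and every x + g with g ∈ Fix is of the form λ_a(x), applying λ_a
-- to y gives (x + g) + (x + g) = x + x: conjugation by x inverts Fix, so Fix is abelian. With
-- λ_a(x) = θ(a) + x, both operations of A are expressed through φ = θ|Fix, z = θ(x) and y.
-- Conversely, in a model λ_(f,k)(g,l) = (g + (-1)^k ψ(f,k,l), l), and surjectivity of ψ makes
-- F × {1} the only nontrivial orbit.

module Submission where

open import Defs
open import Algebra.Bundles using (AbelianGroup; Group; RawGroup)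
open import Algebra.Morphism.Structures using (IsGroupHomomorphism; IsGroupIsomorphism)
open import Algebra.Structures using (IsGroup)
import Algebra.Morphism.GroupMonomorphism as GroupMonomorphism
import Algebra.Properties.AbelianGroup as AbelianGroupProperties
import Algebra.Properties.Group as GroupProperties
open import Data.Bool.Base using (Bool; true; false)
open import Data.Fin.Base using (Fin; zero; suc)
import Data.Fin.Properties as Fin
open import Data.Fin.Subset using (Subset; _∈_; ∣_∣; ⁅_⁆)
open import Data.Fin.Subset.Properties
  using (p⊆q⇒∣p∣≤∣q∣; p⊂q⇒∣p∣<∣q∣; ∣⁅x⁆∣≡1; x∈⁅x⁆; x∈⁅y⁆⇒x≡y; ⊆-antisym)
open import Data.Nat.Base as ℕ using (ℕ; _<_; _≤_)
open import Data.Nat.Properties using (≤-refl; ≤⇒≯)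
open import Data.Parity.Base using (Parity; 0ℙ; 1ℙ)
open import Data.Product.Base using (Σ; _×_; _,_; ∃-syntax; proj₁; proj₂)
open import Data.Vec.Base using (tabulate)
open import Data.Vec.Properties using ([]=⇒lookup; lookup⇒[]=; lookup∘tabulate)
open import Function.Base using (_∘′_)
open import Function.Bundles using (Inverse; _⇔_; mk⇔; Equivalence)
open import Function.Definitions using (Injective)
open import Level using (_⊔_)
open import Relation.Binary.Bundles using (Setoid)
open import Relation.Binary.Core using (Rel)
open import Relation.Binary.Definitions using (Decidable)
open import Relation.Binary.PropositionalEquality as ≡ using (_≡_; _≢_)
import Relation.Binary.Reasoning.Setoid as ≈-Reasoning
open import Relation.Nullary.Decidable as Dec
  using (Dec; yes; no; does; dec-true; True; toWitness; fromWitness)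
open import Relation.Nullary.Negation using (¬_; contradiction)
import Relation.Unary as U

-- The lambda-action and its fixed points.

module Action {c ℓ} (A : SkewBrace c ℓ) where
  open SkewBrace A
  open Group +-group public
    using (refl; sym; trans; assoc; identityˡ; identityʳ; inverseˡ; inverseʳ; _-_)
    renaming (∙-cong to +-cong; ∙-congˡ to +-congˡ; ∙-congʳ to +-congʳ; ⁻¹-cong to -‿cong)
  open GroupProperties +-group public
    using (⁻¹-involutive; ⁻¹-anti-homo-∙)
    renaming (∙-cancelˡ to +-cancelˡ; ∙-cancelʳ to +-cancelʳ; \\-leftDividesˡ to a+[-a+b]≈b;
              \\-leftDividesʳ to -a+[a+b]≈b; //-rightDividesˡ to [b-a]+a≈b;
              //-rightDividesʳ to [b+a]-a≈b; identityʳ-unique to a+b≈a⇒b≈0;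
              inverseʳ-unique to a+b≈0⇒b≈-a;
              x≈z//y to a+b≈c⇒a≈c-b)
  module ∘ where
    open Group ∘-group public
    open GroupProperties ∘-group public
  open ≈-Reasoning setoid

  act-cong : ∀ {a a′ b b′} → a ≈ a′ → b ≈ b′ → act a b ≈ act a′ b′
  act-cong p q = +-cong (-‿cong p) (∘.∙-cong p q)

  a∘b≈a+act : ∀ a b → a ∘ b ≈ a + act a b
  a∘b≈a+act a b = sym (a+[-a+b]≈b a (a ∘ b))

  act-+ : ∀ a b c → act a (b + c) ≈ act a b + act a c
  act-+ a b c = begin
    - a + a ∘ (b + c)            ≈⟨ +-congˡ (distrib a b c) ⟩
    - a + (a ∘ b + - a + a ∘ c)  ≈⟨ +-congˡ (assoc _ _ _) ⟩
    - a + (a ∘ b + act a c)      ≈⟨ assoc _ _ _ ⟨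
    act a b + act a c            ∎

  act-0 : ∀ a → act a 0# ≈ 0#
  act-0 a = a+b≈a⇒b≈0 (act a 0#) (act a 0#)
    (trans (sym (act-+ a 0# 0#)) (act-cong refl (identityˡ 0#)))

  act-neg : ∀ a b → act a (- b) ≈ - act a b
  act-neg a b = a+b≈0⇒b≈-a _ _ (begin
    act a b + act a (- b)  ≈⟨ act-+ a b (- b) ⟨
    act a (b + - b)        ≈⟨ act-cong refl (inverseʳ b) ⟩
    act a 0#               ≈⟨ act-0 a ⟩
    0#                     ∎)

  -- Both sides, added to `a ∘ b`, give the triple product of `a`, `b` and `c`.
  act-∘ : ∀ a b c → act (a ∘ b) c ≈ act a (act b c)
  act-∘ a b c = +-cancelˡ (a ∘ b) _ _ (begin
    a ∘ b + act (a ∘ b) c            ≈⟨ a∘b≈a+act (a ∘ b) c ⟨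
    a ∘ b ∘ c                        ≈⟨ ∘.assoc a b c ⟩
    a ∘ (b ∘ c)                      ≈⟨ ∘.∙-congˡ (a∘b≈a+act b c) ⟩
    a ∘ (b + act b c)                ≈⟨ a∘b≈a+act a _ ⟩
    a + act a (b + act b c)          ≈⟨ +-congˡ (act-+ a b _) ⟩
    a + (act a b + act a (act b c))  ≈⟨ assoc _ _ _ ⟨
    a + act a b + act a (act b c)    ≈⟨ +-congʳ (a∘b≈a+act a b) ⟨
    a ∘ b + act a (act b c)          ∎)

  -- Since `act 1# 0#` vanishes, the unit law for `1# ∘ 0#` reads `1# + 0# ≈ 0#`.
  1≈0 : 1# ≈ 0#
  1≈0 = begin
    1#              ≈⟨ identityʳ 1# ⟨
    1# + 0#         ≈⟨ +-congˡ (act-0 1#) ⟨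
    1# + act 1# 0#  ≈⟨ a∘b≈a+act 1# 0# ⟨
    1# ∘ 0#         ≈⟨ ∘.identityˡ 0# ⟩
    0#              ∎

  act-1 : ∀ b → act 1# b ≈ b
  act-1 b = begin
    - 1# + 1# ∘ b  ≈⟨ +-congˡ (∘.identityˡ b) ⟩
    - 1# + b       ≈⟨ +-congˡ (trans (+-congʳ 1≈0) (identityˡ b)) ⟨
    - 1# + (1# + b) ≈⟨ -a+[a+b]≈b 1# b ⟩
    b              ∎

  act-⁻¹ : ∀ {a b c} → act a b ≈ c → act (a ⁻¹) c ≈ b
  act-⁻¹ {a} {b} {c} p = begin
    act (a ⁻¹) c          ≈⟨ act-cong refl p ⟨
    act (a ⁻¹) (act a b)  ≈⟨ act-∘ (a ⁻¹) a b ⟨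
    act (a ⁻¹ ∘ a) b      ≈⟨ act-cong (∘.inverseˡ a) refl ⟩
    act 1# b              ≈⟨ act-1 b ⟩
    b                     ∎

  Fixed : Carrier → Set (c ⊔ ℓ)
  Fixed b = ∀ a → act a b ≈ b

  Fixed-resp : ∀ {b c} → b ≈ c → Fixed b → Fixed c
  Fixed-resp b≈c fb a = trans (act-cong refl (sym b≈c)) (trans (fb a) b≈c)

  Fixed-0 : Fixed 0#
  Fixed-0 = act-0

  Fixed-+ : ∀ {b c} → Fixed b → Fixed c → Fixed (b + c)
  Fixed-+ fb fc a = trans (act-+ a _ _) (+-cong (fb a) (fc a))

  Fixed-neg : ∀ {b} → Fixed b → Fixed (- b)
  Fixed-neg fb a = trans (act-neg a _) (-‿cong (fb a))

  Fixed-+⁻ : ∀ {b c} → Fixed b → Fixed (b + c) → Fixed c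
  Fixed-+⁻ {b} {c} fb fbc = Fixed-resp (-a+[a+b]≈b b c) (Fixed-+ (Fixed-neg fb) fbc)

  -- Acting by `a ⁻¹` returns `b` from `act a b`, yet leaves a fixed point unchanged, so the two
  -- coincide.
  Fixed-act⁻ : ∀ {a b} → Fixed (act a b) → Fixed b
  Fixed-act⁻ {a} f = Fixed-resp (trans (sym (f (a ⁻¹))) (act-⁻¹ refl)) f

  -- For `b` not fixed, this says that the subgroup of fixed points has index two, its complement
  -- being the left coset of `b`.
  IndexTwo : Carrier → Set (c ⊔ ℓ)
  IndexTwo b = ∀ {c} → ¬ Fixed c → Fixed (- b + c)

  -- The graph-free form of having exactly one vertex: orbits of size greater than 1 are those of
  -- non-fixed points.
  record SingleOrbit (b : Carrier) : Set (c ⊔ ℓ) where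
    field
      ¬fixed     : ¬ Fixed b
      transitive : ∀ c → ¬ Fixed c → ∃[ a ] c ≈ act a b

-- Decidability and counting through the enumeration.

module FiniteSkewBrace {c ℓ} (A : SkewBrace c ℓ) (finite : Finite (SkewBrace.setoid A)) where
  open SkewBrace A
  open Action A
  open Inverse (proj₂ finite) public using (to; from; to-cong; from-cong)

  size = proj₁ finite

  from-to : ∀ a → from (to a) ≈ a
  from-to a = Inverse.inverseʳ (proj₂ finite) ≡.refl

  to-from : ∀ i → to (from i) ≡ i
  to-from i = Inverse.inverseˡ (proj₂ finite) refl

  to-injective : ∀ {a b} → to a ≡ to b → a ≈ b
  to-injective p = trans (sym (from-to _)) (trans (from-cong p) (from-to _))

  from-injective : ∀ {i j} → from i ≈ from j → i ≡ j
  from-injective p = ≡.trans (≡.sym (to-from _)) (≡.trans (to-cong p) (to-from _))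

  infix 4 _≟_
  _≟_ : Decidable _≈_
  a ≟ b = Dec.map′ to-injective to-cong (to a Fin.≟ to b)

  fixed? : U.Decidable Fixed
  fixed? b = Dec.map′
    (λ f a → trans (act-cong (sym (from-to a)) refl) (f (to a)))
    (λ f i → f (from i))
    (Fin.all? (λ i → act (from i) b ≟ b))

  orbit? : ∀ b c → Dec (∃[ a ] c ≈ act a b)
  orbit? b c = Dec.map′
    (λ (i , p) → from i , p)
    (λ (a , p) → to a , trans p (act-cong (sym (from-to a)) refl))
    (Fin.any? (λ i → c ≟ act (from i) b))

  pigeonhole : (p : Fin (ℕ.suc size) → Carrier) → ∃[ i ] ∃[ j ] (i ≢ j × p i ≈ p j)
  pigeonhole p with Fin.pigeonhole ≤-refl (to ∘′ p)
  ... | i , j , i<j , eq = i , j , Fin.<⇒≢ i<j , to-injective eq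

  -- The fixed points have index two.

  module Index {b} (single : SingleOrbit b) where
    open SingleOrbit single

    -- The orbit of `b` misses `0#`, because `b` is not fixed. Among `0#` and the `size` images of
    -- `b`, the pigeonhole principle therefore makes two images under distinct elements agree, and
    -- the quotient of these elements stabilises `b`.
    stabiliser-nontrivial : ∃[ h ] (¬ h ≈ 1# × act h b ≈ b)
    stabiliser-nontrivial with pigeonhole (λ { zero → 0# ; (suc i) → act (from i) b })
    ... | zero  , zero  , i≢j , _ = contradiction ≡.refl i≢j
    ... | zero  , suc j , _ , eq = contradiction (Fixed-act⁻ (Fixed-resp eq Fixed-0)) ¬fixed
    ... | suc i , zero  , _ , eq = contradiction (Fixed-act⁻ (Fixed-resp (sym eq) Fixed-0)) ¬fixed
    ... | suc i , suc j , i≢j , eq =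
      from j ⁻¹ ∘ from i
      , (λ eq′ → i≢j (≡.cong suc (from-injective
          (sym (∘.⁻¹-injective (∘.inverseˡ-unique _ _ eq′))))))
      , trans (act-∘ _ _ _) (act-⁻¹ (sym eq))

    h = proj₁ stabiliser-nontrivial

    -- Chosen along the enumeration, so that equal points have identical transporters.
    transporter : Fin size → Carrier
    transporter i with orbit? b (from i)
    ... | yes (a , _) = a
    ... | no  _       = 0#

    act-transporter : ∀ {c} → ¬ Fixed c → act (transporter (to c)) b ≈ c
    act-transporter {c} ¬fc with orbit? b (from (to c))
    ... | yes (a , p) = trans (sym p) (from-to c)
    ... | no  ¬p      = let a , p = transitive c ¬fc in
                        contradiction (a , trans (from-to c) p) ¬p

    -- For non-fixed `c`, both values carry `b` to `c`; this is the doubling behind the bound of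
    -- twice the orbit size by the order of `A`.
    code : Carrier × Bool → Carrier
    code (c , false) = transporter (to c)
    code (c , true)  = transporter (to c) ∘ h

    act-code : ∀ {c} → ¬ Fixed c → ∀ ε → act (code (c , ε)) b ≈ c
    act-code ¬fc false = act-transporter ¬fc
    act-code ¬fc true  = trans (act-∘ _ h b)
      (trans (act-cong refl (proj₂ (proj₂ stabiliser-nontrivial))) (act-transporter ¬fc))

    -- Acting on `b` recovers `c`, hence the transporter; cancelling it, differing bits would force
    -- `h ≈ 1#`.
    code-injective : ∀ {c c′ ε ε′} → ¬ Fixed c → ¬ Fixed c′ →
                     code (c , ε) ≈ code (c′ , ε′) → c ≈ c′ × ε ≡ ε′
    code-injective {c} {c′} {ε} {ε′} ¬fc ¬fc′ eq = c≈c′ , bits ε ε′ eq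
      where
      c≈c′ : c ≈ c′
      c≈c′ = trans (sym (act-code ¬fc ε)) (trans (act-cong eq refl) (act-code ¬fc′ ε′))

      same : transporter (to c) ≡ transporter (to c′)
      same = ≡.cong transporter (to-cong c≈c′)

      h≉1 = proj₁ (proj₂ stabiliser-nontrivial)

      bits : ∀ ε ε′ → code (c , ε) ≈ code (c′ , ε′) → ε ≡ ε′
      bits false false _ = ≡.refl
      bits true  true  _ = ≡.refl
      bits false true  p rewrite same =
        contradiction (∘.identityʳ-unique _ h (sym p)) h≉1
      bits true  false p rewrite same =
        contradiction (∘.identityʳ-unique _ h p) h≉1

    -- If c ∉ b + Fix(A), the codes of (l , false) for l ∉ Fix(A), of (b + f , true) for
    -- f ∈ Fix(A), and of (c , true) would be |A| + 1 distinct elements of A.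
    index-two : IndexTwo b
    index-two {c} ¬fc with fixed? (- b + c)
    ... | yes f = f
    ... | no ¬f = absurd
      where
      point : Fin (ℕ.suc size) → Carrier × Bool
      point zero = c , true
      point (suc i) with fixed? (from i)
      ... | yes _ = b + from i , true
      ... | no  _ = from i , false

      ¬fixed-point : ∀ i → ¬ Fixed (proj₁ (point i))
      ¬fixed-point zero = ¬fc
      ¬fixed-point (suc i) with fixed? (from i)
      ... | yes f = λ f′ → ¬fixed (Fixed-resp ([b+a]-a≈b _ _) (Fixed-+ f′ (Fixed-neg f)))
      ... | no ¬f = ¬f

      -- The bit separates fixed from non-fixed indices; a clash of `c` with some `b + f` is
      -- excluded because `- b + c` is not fixed.
      point-injective : ∀ i j → proj₁ (point i) ≈ proj₁ (point j) →
                        proj₂ (point i) ≡ proj₂ (point j) → i ≡ j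
      point-injective zero zero _ _ = ≡.refl
      point-injective zero (suc j) p q with fixed? (from j)
      ... | yes f = contradiction (Fixed-resp (trans (sym (-a+[a+b]≈b b _)) (+-congˡ (sym p))) f) ¬f
      point-injective zero (suc j) p () | no _
      point-injective (suc i) zero p q with fixed? (from i)
      ... | yes f = contradiction (Fixed-resp (trans (sym (-a+[a+b]≈b b _)) (+-congˡ p)) f) ¬f
      point-injective (suc i) zero p () | no _
      point-injective (suc i) (suc j) p q with fixed? (from i) | fixed? (from j)
      ... | yes _ | yes _ = ≡.cong suc (from-injective (+-cancelˡ b _ _ p))
      ... | no  _ | no  _ = ≡.cong suc (from-injective p)
      point-injective (suc i) (suc j) p () | yes _ | no _
      point-injective (suc i) (suc j) p () | no _ | yes _

      absurd : Fixed (- b + c)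
      absurd with pigeonhole (code ∘′ point)
      ... | i , j , i≢j , eq with code-injective (¬fixed-point i) (¬fixed-point j) eq
      ...   | p , q = contradiction (point-injective i j p q) i≢j

-- Transport of group structures and enumeration of decidable subsets.

module _ {c ℓ} (G : Group c ℓ) where
  open Group G hiding (isGroup)

  -- The group laws are pulled back along the injection `f`, with neutral element and inverses
  -- supplied by `g`. Only `f-g` is assumed of `g`; the other composite is the identity by
  -- injectivity.
  module Transport {b ℓ′} {B : Set b} (_≈′_ : Rel B ℓ′) (_∙′_ : B → B → B)
    (f : B → Carrier) (g : Carrier → B)
    (f-cong : ∀ {p q} → p ≈′ q → f p ≈ f q)
    (f-injective : ∀ {p q} → f p ≈ f q → p ≈′ q)
    (f-g : ∀ a → f (g a) ≈ a)
    (homo : ∀ p q → f (p ∙′ q) ≈ f p ∙ f q)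
    where

    transported : RawGroup b ℓ′
    transported = record { _≈_ = _≈′_ ; _∙_ = _∙′_ ; ε = g ε ; _⁻¹ = λ p → g (f p ⁻¹) }

    isGroup : IsGroup _≈′_ _∙′_ (g ε) (λ p → g (f p ⁻¹))
    isGroup = GroupMonomorphism.isGroup {G₁ = transported} {G₂ = rawGroup} (record
      { isGroupHomomorphism = record
        { isMonoidHomomorphism = record
          { isMagmaHomomorphism = record
            { isRelHomomorphism = record { cong = f-cong }
            ; homo = homo
            }
          ; ε-homo = f-g ε
          }
        ; ⁻¹-homo = λ p → f-g _
        }
      ; injective = f-injective
      }) (Group.isGroup G)

    isIso : IsGroupIsomorphism rawGroup transported g
    isIso = record
      { isGroupMonomorphism = record
        { isGroupHomomorphism = record
          { isMonoidHomomorphism = record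
            { isMagmaHomomorphism = record
              { isRelHomomorphism = record { cong = λ p → f-injective (trans (f-g _) (trans p (sym (f-g _)))) }
              ; homo = λ a b → f-injective (trans (f-g _) (sym (trans (homo _ _) (∙-cong (f-g a) (f-g b)))))
              }
            ; ε-homo = f-injective refl
            }
          ; ⁻¹-homo = λ a → f-injective (trans (f-g _) (sym (trans (f-g _) (⁻¹-cong (f-g a)))))
          }
        ; injective = λ p → trans (sym (f-g _)) (trans (f-cong p) (f-g _))
        }
      ; surjective = λ p → f p , λ q → f-injective (trans (f-g _) q)
      }

-- Serves to put the decidable subset of fixed points in bijection with some `Fin m`.
enumerate : ∀ {n p} {P : U.Pred (Fin n) p} → U.Decidable P →
            ∃[ m ] Σ (Fin m → Fin n) λ e →
              (∀ i → P (e i)) × Injective _≡_ _≡_ e × (∀ j → P j → ∃[ i ] e i ≡ j)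
enumerate {ℕ.zero} P? = 0 , (λ ()) , (λ ()) , (λ { {()} }) , λ ()
enumerate {ℕ.suc n} P? with P? zero | enumerate (λ i → P? (suc i))
... | no ¬p | m , e , sound , injective , complete =
  m , suc ∘′ e , sound , (λ eq → injective (Fin.suc-injective eq)) ,
  λ { zero p → contradiction p ¬p
    ; (suc j) p → let i , eq = complete j p in i , ≡.cong suc eq }
... | yes p | m , e , sound , injective , complete =
  ℕ.suc m , (λ { zero → zero ; (suc i) → suc (e i) }) ,
  (λ { zero → p ; (suc i) → sound i }) ,
  (λ { {zero} {zero} _ → ≡.refl
     ; {suc i} {suc j} eq → ≡.cong suc (injective (Fin.suc-injective eq)) }) ,
  λ { zero _ → zero , ≡.refl
    ; (suc j) q → let i , eq = complete j q in suc i , ≡.cong suc eq }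

-- The additive group, from a single orbit and index two.

module Reconstruct {c ℓ} (A : SkewBrace c ℓ) {x : SkewBrace.Carrier A}
  (single : Action.SingleOrbit A x) (fixed? : U.Decidable (Action.Fixed A))
  (index-two : Action.IndexTwo A x) where

  open SkewBrace A
  open Action A
  open SingleOrbit single
  open ≈-Reasoning setoid

  y : Carrier
  y = x + x

  -- Otherwise index two would make `- x + (x + x)`, that is `x`, fixed.
  Fixed-y : Fixed y
  Fixed-y with fixed? y
  ... | yes f = f
  ... | no ¬f = contradiction (Fixed-resp (-a+[a+b]≈b x x) (index-two ¬f)) ¬fixed

  -- Every fixed g satisfies x + g = λ_a(x) for some a, and λ_a(x) + λ_a(x) = λ_a(y) = y.
  g+x≈x-g : ∀ {g} → Fixed g → g + x ≈ x - g
  g+x≈x-g {g} fg = a+b≈c⇒a≈c-b _ _ _ (+-cancelˡ x _ _ (begin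
    x + (g + x + g)    ≈⟨ +-congˡ (assoc g x g) ⟩
    x + (g + (x + g))  ≈⟨ assoc x g _ ⟨
    x + g + (x + g)    ≈⟨ +-cong p p ⟩
    act a x + act a x  ≈⟨ act-+ a x x ⟨
    act a y            ≈⟨ Fixed-y a ⟩
    x + x              ∎))
    where
    moved = transitive (x + g) λ f →
      ¬fixed (Fixed-resp ([b+a]-a≈b g x) (Fixed-+ f (Fixed-neg fg)))
    a = proj₁ moved
    p = proj₂ moved

  x+g≈-g+x : ∀ {g} → Fixed g → x + g ≈ - g + x
  x+g≈-g+x {g} fg = trans (+-congˡ (sym (⁻¹-involutive g))) (sym (g+x≈x-g (Fixed-neg fg)))

  -- Brings sums to a normal form with `x` on the right.
  f+x+g : ∀ f {g} → Fixed g → f + x + g ≈ f - g + x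
  f+x+g f fg = trans (assoc _ _ _) (trans (+-congˡ (x+g≈-g+x fg)) (sym (assoc _ _ _)))

  -- Conjugation by `x` is inversion on fixed points, and inversion is a homomorphism only on an
  -- abelian group.
  Fixed-comm : ∀ {f g} → Fixed f → Fixed g → f + g ≈ g + f
  Fixed-comm {f} {g} ff fg = +-cancelʳ x _ _ (begin
    f + g + x      ≈⟨ g+x≈x-g (Fixed-+ ff fg) ⟩
    x - (f + g)    ≈⟨ +-congˡ (⁻¹-anti-homo-∙ f g) ⟩
    x + (- g - f)  ≈⟨ assoc x _ _ ⟨
    x - g - f      ≈⟨ +-congʳ (g+x≈x-g fg) ⟨
    g + x - f      ≈⟨ assoc g x _ ⟩
    g + (x - f)    ≈⟨ +-congˡ (g+x≈x-g ff) ⟨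
    g + (f + x)    ≈⟨ assoc g f x ⟨
    g + f + x      ∎)

  -- Index two concerns the left coset of `x`; moving `x` past the fixed element `- x + a` inverts
  -- it and gives the right coset.
  Fixed-a-x : ∀ {a} → ¬ Fixed a → Fixed (a - x)
  Fixed-a-x {a} ¬fa = Fixed-resp (sym (begin
    a - x              ≈⟨ +-congʳ (a+[-a+b]≈b x a) ⟨
    x + (- x + a) - x  ≈⟨ +-congʳ (x+g≈-g+x f) ⟩
    - (- x + a) + x - x ≈⟨ [b+a]-a≈b x _ ⟩
    - (- x + a)        ∎)) (Fixed-neg f)
    where f = index-two ¬fa

  -- The translation part `θ` of the action and its identities.

  θ : Carrier → Carrier
  θ a = act a x - x

  Fixed-θ : ∀ a → Fixed (θ a)
  Fixed-θ a = Fixed-a-x (¬fixed ∘′ Fixed-act⁻)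

  θ-cong : ∀ {a b} → a ≈ b → θ a ≈ θ b
  θ-cong p = +-congʳ (act-cong p refl)

  act-f+x : ∀ a {f} → Fixed f → act a (f + x) ≈ f + θ a + x
  act-f+x a {f} ff = begin
    act a (f + x)      ≈⟨ act-+ a f x ⟩
    act a f + act a x  ≈⟨ +-cong (ff a) (sym ([b-a]+a≈b x _)) ⟩
    f + (θ a + x)      ≈⟨ assoc _ _ _ ⟨
    f + θ a + x        ∎

  -- On the coset of `x` each `act a` is translation by `θ a`, and translations compose by addition.
  θ-∘ : ∀ a b → θ (a ∘ b) ≈ θ a + θ b
  θ-∘ a b = begin
    act (a ∘ b) x - x      ≈⟨ +-congʳ (act-∘ a b x) ⟩
    act a (act b x) - x    ≈⟨ +-congʳ (act-cong refl ([b-a]+a≈b x _)) ⟨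
    act a (θ b + x) - x    ≈⟨ +-congʳ (act-f+x a (Fixed-θ b)) ⟩
    θ b + θ a + x - x      ≈⟨ [b+a]-a≈b x _ ⟩
    θ b + θ a              ≈⟨ Fixed-comm (Fixed-θ b) (Fixed-θ a) ⟩
    θ a + θ b              ∎

  a∘g≈a+g : ∀ a {g} → Fixed g → a ∘ g ≈ a + g
  a∘g≈a+g a fg = trans (a∘b≈a+act a _) (+-congˡ (fg a))

  -- For fixed `g` the sum `a + g` is the product `a ∘ g`, so `θ-∘` applies.
  θ-+ : ∀ a {g} → Fixed g → θ (a + g) ≈ θ a + θ g
  θ-+ a {g} fg = trans (θ-cong (sym (a∘g≈a+g a fg))) (θ-∘ a g)

  θ-0 : θ 0# ≈ 0#
  θ-0 = a+b≈a⇒b≈0 _ _ (trans (sym (θ-+ 0# Fixed-0)) (θ-cong (identityˡ 0#)))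

  θ-neg : ∀ {g} → Fixed g → θ (- g) ≈ - θ g
  θ-neg {g} fg = a+b≈0⇒b≈-a _ _
    (trans (sym (θ-+ g (Fixed-neg fg))) (trans (θ-cong (inverseʳ g)) θ-0))

  -- The sign appears because `f` must first be moved to the right of `x`, where `θ-+` applies.
  θ-f+x : ∀ {f} → Fixed f → θ (f + x) ≈ θ x - θ f
  θ-f+x {f} ff = trans (θ-cong (g+x≈x-g ff)) (trans (θ-+ x (Fixed-neg ff)) (+-congˡ (θ-neg ff)))

  [f+x]∘[g+x] : ∀ {f g} → Fixed f → Fixed g →
                (f + x) ∘ (g + x) ≈ f - (g + (θ x - θ f)) + y
  [f+x]∘[g+x] {f} {g} ff fg = begin
    (f + x) ∘ (g + x)            ≈⟨ a∘b≈a+act (f + x) (g + x) ⟩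
    f + x + act (f + x) (g + x)  ≈⟨ +-congˡ (act-f+x (f + x) fg) ⟩
    f + x + (g + θ (f + x) + x)  ≈⟨ assoc _ _ _ ⟨
    f + x + (g + θ (f + x)) + x  ≈⟨ +-congʳ (f+x+g f (Fixed-+ fg (Fixed-θ _))) ⟩
    f - (g + θ (f + x)) + x + x  ≈⟨ assoc _ _ _ ⟩
    f - (g + θ (f + x)) + y      ≈⟨ +-congʳ (+-congˡ (-‿cong (+-congˡ (θ-f+x ff)))) ⟩
    f - (g + (θ x - θ f)) + y    ∎

  f∘[g+x] : ∀ f {g} → Fixed g → f ∘ (g + x) ≈ f + g + θ f + x
  f∘[g+x] f {g} fg = begin
    f ∘ (g + x)          ≈⟨ a∘b≈a+act f (g + x) ⟩
    f + act f (g + x)    ≈⟨ +-congˡ (act-f+x f fg) ⟩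
    f + (g + θ f + x)    ≈⟨ assoc _ _ _ ⟨
    f + (g + θ f) + x    ≈⟨ +-congʳ (assoc _ _ _) ⟨
    f + g + θ f + x      ∎

  -- Compare θ(f ∘ x) = θ(f) + θ(x) with θ(f + θ(f) + x).
  θθ≈-2θ : ∀ {f} → Fixed f → θ (θ f) ≈ - (θ f + θ f)
  θθ≈-2θ {f} ff = a+b≈0⇒b≈-a _ _ (begin
    θ f + θ f + θ (θ f)    ≈⟨ assoc _ _ _ ⟩
    θ f + (θ f + θ (θ f))  ≈⟨ +-congˡ (θ-+ f (Fixed-θ f)) ⟨
    θ f + θ (f + θ f)      ≈⟨ +-congʳ θf≈ ⟩
    - θ (f + θ f) + θ (f + θ f) ≈⟨ inverseˡ _ ⟩
    0#                     ∎)
    where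
    θf≈ : θ f ≈ - θ (f + θ f)
    θf≈ = +-cancelˡ (θ x) _ _ (begin
      θ x + θ f            ≈⟨ Fixed-comm (Fixed-θ x) (Fixed-θ f) ⟩
      θ f + θ x            ≈⟨ θ-∘ f x ⟨
      θ (f ∘ x)            ≈⟨ θ-cong (∘.∙-congˡ (identityˡ x)) ⟨
      θ (f ∘ (0# + x))     ≈⟨ θ-cong (f∘[g+x] f Fixed-0) ⟩
      θ (f + 0# + θ f + x) ≈⟨ θ-cong (+-congʳ (+-congʳ (identityʳ f))) ⟩
      θ (f + θ f + x)      ≈⟨ θ-f+x (Fixed-+ ff (Fixed-θ f)) ⟩
      θ x - θ (f + θ f)    ∎)

  -- Evaluates `θ` at `x ∘ x + θ x`, which is `y` because moving `θ x` past `x` cancels the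
  -- translation in `act x x`.
  θθx≈θy-2θx : θ (θ x) ≈ θ y - (θ x + θ x)
  θθx≈θy-2θx = a+b≈c⇒a≈c-b _ _ _ (trans
    (Fixed-comm (Fixed-θ _) (Fixed-+ (Fixed-θ _) (Fixed-θ _))) (begin
    θ x + θ x + θ (θ x)             ≈⟨ +-congʳ (θ-∘ x x) ⟨
    θ (x ∘ x) + θ (θ x)             ≈⟨ θ-+ (x ∘ x) (Fixed-θ x) ⟨
    θ (x ∘ x + θ x)                 ≈⟨ θ-cong x∘x+θx≈y ⟩
    θ y                             ∎))
    where
    x∘x+θx≈y : x ∘ x + θ x ≈ y
    x∘x+θx≈y = begin
      x ∘ x + θ x              ≈⟨ +-congʳ (a∘b≈a+act x x) ⟩
      x + act x x + θ x        ≈⟨ +-congʳ (+-congˡ ([b-a]+a≈b x _)) ⟨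
      x + (θ x + x) + θ x      ≈⟨ +-congʳ (assoc _ _ _) ⟨
      x + θ x + x + θ x        ≈⟨ f+x+g (x + θ x) (Fixed-θ x) ⟩
      x + θ x - θ x + x        ≈⟨ +-congʳ ([b+a]-a≈b (θ x) x) ⟩
      x + x                    ∎

  -- Conjugation by `x` inverts the fixed point `y`, but also fixes it, since `y` is a multiple of
  -- `x`.
  y≈-y : y ≈ - y
  y≈-y = +-cancelʳ x _ _ (trans (assoc x x x) (x+g≈-g+x Fixed-y))

  -- `Fixed a` lives in level `c ⊔ ℓ`; replacing it by `True` of its decision keeps the carrier of
  -- `F` in level `c`.
  FixedPoint : Set c
  FixedPoint = Σ Carrier λ a → True (fixed? a)

  fixed : ∀ {a} → Fixed a → FixedPoint
  fixed fa = _ , fromWitness fa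

  isFixed : (f : FixedPoint) → Fixed (proj₁ f)
  isFixed f = toWitness (proj₂ f)

  F : AbelianGroup c ℓ
  F = record
    { _≈_ = λ f g → proj₁ f ≈ proj₁ g
    ; _∙_ = λ f g → fixed (Fixed-+ (isFixed f) (isFixed g))
    ; ε   = fixed Fixed-0
    ; _⁻¹ = λ f → fixed (Fixed-neg (isFixed f))
    ; isAbelianGroup = record
      { isGroup = GroupMonomorphism.isGroup {⟦_⟧ = proj₁} (record
        { isGroupHomomorphism = record
          { isMonoidHomomorphism = record
            { isMagmaHomomorphism = record
              { isRelHomomorphism = record { cong = λ p → p }
              ; homo = λ _ _ → refl
              }
            ; ε-homo = refl
            }
          ; ⁻¹-homo = λ _ → refl
          }
        ; injective = λ p → p
        }) +-isGroup
      ; comm = λ f g → Fixed-comm (isFixed f) (isFixed g)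
      }
    }

  F-finite : Finite setoid → Finite (AbelianGroup.setoid F)
  F-finite finite = let m , e , sound , injective , complete = enumerate (λ i → fixed? (from i)) in
    m , record
      { to = λ f → proj₁ (complete (to (proj₁ f)) (Fixed-resp (sym (from-to _)) (isFixed f)))
      ; from = λ i → fixed (sound i)
      ; to-cong = λ p → injective (≡.trans (proj₂ (complete _ _))
                          (≡.trans (to-cong p) (≡.sym (proj₂ (complete _ _)))))
      ; from-cong = λ { ≡.refl → refl }
      ; inverse = (λ p → injective (≡.trans (proj₂ (complete _ _)) (≡.trans (to-cong p) (to-from _))))
                , λ { ≡.refl → trans (from-cong (proj₂ (complete _ _))) (from-to _) }
      }
    where open FiniteSkewBrace A finite using (to; from; to-cong; from-cong; to-from; from-to)

  -- If `F` were trivial, every `θ a` would vanish and `x` would be fixed.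
  F-nontrivial : ¬ (∀ f → AbelianGroup._≈_ F f (AbelianGroup.ε F))
  F-nontrivial F≈0 = ¬fixed λ a →
    trans (sym ([b-a]+a≈b x _)) (trans (+-congʳ (F≈0 (fixed (Fixed-θ a)))) (identityˡ x))

  private
    module F where
      open AbelianGroup F public
      open AbelianGroupProperties F public
    module M = Model F

  -- Coordinates on `A` and the model operations.

  pair : Carrier → M.Carrier × Parity
  pair a with fixed? a
  ... | yes fa = fixed fa , 0ℙ
  ... | no ¬fa = fixed (Fixed-a-x ¬fa) , 1ℙ

  unpair : M.Carrier × Parity → Carrier
  unpair (f , 0ℙ) = proj₁ f
  unpair (f , 1ℙ) = proj₁ f + x

  unpair-pair : ∀ a → unpair (pair a) ≈ a
  unpair-pair a with fixed? a
  ... | yes _ = refl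
  ... | no  _ = [b-a]+a≈b x a

  unpair-cong : ∀ {p q} → Setoid._≈_ M.pairs p q → unpair p ≈ unpair q
  unpair-cong {_ , 0ℙ} (p , ≡.refl) = p
  unpair-cong {_ , 1ℙ} (p , ≡.refl) = +-congʳ p

  unpair-injective : ∀ {p q} → unpair p ≈ unpair q → Setoid._≈_ M.pairs p q
  unpair-injective {_ , 0ℙ} {_ , 0ℙ} p = p , ≡.refl
  unpair-injective {_ , 1ℙ} {_ , 1ℙ} p = +-cancelʳ x _ _ p , ≡.refl
  unpair-injective {f , 0ℙ} {g , 1ℙ} p =
    contradiction (Fixed-+⁻ (isFixed g) (Fixed-resp p (isFixed f))) ¬fixed
  unpair-injective {f , 1ℙ} {g , 0ℙ} p =
    contradiction (Fixed-+⁻ (isFixed f) (Fixed-resp (sym p) (isFixed g))) ¬fixed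

  yF zF : M.Carrier
  yF = fixed Fixed-y
  zF = fixed (Fixed-θ x)

  φ : M.Carrier → M.Carrier
  φ f = fixed (Fixed-θ (proj₁ f))

  unpair-add : ∀ p q → unpair (M.add yF p q) ≈ unpair p + unpair q
  unpair-add (f , 0ℙ) (g , 0ℙ) = identityʳ _
  unpair-add (f , 0ℙ) (g , 1ℙ) = trans (+-congʳ (identityʳ _)) (assoc _ _ _)
  unpair-add (f , 1ℙ) (g , 0ℙ) = trans (+-congʳ (identityʳ _)) (sym (f+x+g _ (isFixed g)))
  unpair-add (f′ , 1ℙ) (g′ , 1ℙ) = let f = proj₁ f′ ; g = proj₁ g′ in begin
    f - g + (y + 0#)   ≈⟨ +-congˡ (identityʳ y) ⟩
    f - g + y          ≈⟨ assoc _ _ _ ⟨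
    f - g + x + x      ≈⟨ +-congʳ (f+x+g f (isFixed g′)) ⟨
    f + x + g + x      ≈⟨ assoc _ _ _ ⟩
    f + x + (g + x)    ∎

  unpair-mul : ∀ p q → unpair (M.mul yF φ zF p q) ≈ unpair p ∘ unpair q
  unpair-mul (f , 0ℙ) (g , 0ℙ) =
    trans (identityʳ _) (trans (identityʳ _) (sym (a∘g≈a+g _ (isFixed g))))
  unpair-mul (f′ , 0ℙ) (g′ , 1ℙ) = let f = proj₁ f′ ; g = proj₁ g′ in begin
    -- The three `0#` are unfolded multiples: `0 · z`, the tail of a multiple by one, and `0 · y`.
    f + g + (θ f - 0# + 0#) + 0# + x  ≈⟨ +-congʳ (identityʳ _) ⟩
    f + g + (θ f - 0# + 0#) + x       ≈⟨ +-congʳ (+-congˡ (identityʳ _)) ⟩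
    f + g + (θ f - 0#) + x            ≈⟨ +-congʳ (+-congˡ (sym (a+b≈c⇒a≈c-b _ _ _ (identityʳ _)))) ⟩
    f + g + θ f + x                   ≈⟨ f∘[g+x] f (isFixed g′) ⟨
    f ∘ (g + x)                       ∎
  unpair-mul (f , 1ℙ) (g , 0ℙ) = trans
    (+-congʳ (trans (identityʳ _) (identityʳ _)))
    (trans (sym (f+x+g _ (isFixed g))) (sym (a∘g≈a+g _ (isFixed g))))
  unpair-mul (f′ , 1ℙ) (g′ , 1ℙ) = let f = proj₁ f′ ; g = proj₁ g′ in begin
    f - g + (θ f - (θ x + 0#) + 0#) + (y + 0#)  ≈⟨ +-cong (+-congˡ (identityʳ _)) (identityʳ y) ⟩
    f - g + (θ f - (θ x + 0#)) + y              ≈⟨ +-congʳ (+-congˡ (+-congˡ (-‿cong (identityʳ _)))) ⟩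
    f - g + (θ f - θ x) + y                     ≈⟨ +-congʳ (assoc _ _ _) ⟩
    f + (- g + (θ f - θ x)) + y                 ≈⟨ +-congʳ (+-congˡ (+-congˡ (F.⁻¹-anti-homo-// zF (φ f′)))) ⟨
    f + (- g - (θ x - θ f)) + y                 ≈⟨ +-congʳ (+-congˡ (F.⁻¹-∙-comm g′ (zF F.- φ f′))) ⟩
    f - (g + (θ x - θ f)) + y                   ≈⟨ [f+x]∘[g+x] (isFixed f′) (isFixed g′) ⟨
    (f + x) ∘ (g + x)                           ∎

  private
    module Add = Transport +-group (Setoid._≈_ M.pairs) (M.add yF) unpair pair
                   unpair-cong unpair-injective unpair-pair unpair-add
    module Mul = Transport ∘-group (Setoid._≈_ M.pairs) (M.mul yF φ zF) unpair pair
                   unpair-cong unpair-injective unpair-pair unpair-mul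

  -- By transitivity `proj₁ f + x` is some `act a x`, that is `θ a + x`; cancel `x`.
  θ-unpair-covers : ∀ f → ∃[ p ] proj₁ f ≈ θ (unpair p)
  θ-unpair-covers f = pair a , trans (sym ([b+a]-a≈b x _))
    (trans (+-congʳ eq) (θ-cong (sym (unpair-pair a))))
    where
    moved = transitive (proj₁ f + x) (¬fixed ∘′ Fixed-+⁻ (isFixed f))
    a  = proj₁ moved
    eq = proj₂ moved

  _⊕_ = M.add yF
  _⊙_ = M.mul yF φ zF

  model-distrib : ∀ p q r → Setoid._≈_ M.pairs (p ⊙ (q ⊕ r)) (((p ⊙ q) ⊕ pair (- unpair p)) ⊕ (p ⊙ r))
  model-distrib p q r = unpair-injective {p = p ⊙ (q ⊕ r)} {q = ((p ⊙ q) ⊕ pair (- unpair p)) ⊕ (p ⊙ r)} (begin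
          unpair (p ⊙ (q ⊕ r))  ≈⟨ unpair-mul p _ ⟩
          unpair p ∘ unpair (q ⊕ r)  ≈⟨ ∘.∙-congˡ (unpair-add q r) ⟩
          unpair p ∘ (unpair q + unpair r)  ≈⟨ distrib _ _ _ ⟩
          unpair p ∘ unpair q - unpair p + unpair p ∘ unpair r
            ≈⟨ +-cong (+-cong (unpair-mul p q) (unpair-pair _)) (unpair-mul p r) ⟨
          unpair (p ⊙ q) + unpair (pair (- unpair p)) + unpair (p ⊙ r)
            ≈⟨ +-congʳ (unpair-add (p ⊙ q) _) ⟨
          unpair ((p ⊙ q) ⊕ pair (- unpair p)) + unpair (p ⊙ r)
            ≈⟨ unpair-add ((p ⊙ q) ⊕ pair (- unpair p)) (p ⊙ r) ⟨
          unpair (((p ⊙ q) ⊕ pair (- unpair p)) ⊕ (p ⊙ r)) ∎)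

  ψ-cong : ∀ {f g} k₁ k₂ → proj₁ f ≈ proj₁ g →
           proj₁ (M.ψ φ zF f k₁ k₂) ≈ proj₁ (M.ψ φ zF g k₁ k₂)
  ψ-cong k₁ 0ℙ _ = refl
  ψ-cong k₁ 1ℙ p = +-congʳ (+-congʳ (θ-cong p))

  ψ-0-1 : ∀ f → proj₁ (M.ψ φ zF f 0ℙ 1ℙ) ≈ θ (unpair (f , 0ℙ))
  ψ-0-1 f = trans (identityʳ _) (sym (a+b≈c⇒a≈c-b _ _ _ (identityʳ _)))

  -- Together with `ψ-0-1`, this identifies `ψ` at second parity `1ℙ` with `θ` up to a sign given by
  -- the first parity.
  ψ-1-1 : ∀ f → proj₁ (M.ψ φ zF f 1ℙ 1ℙ) ≈ - θ (unpair (f , 1ℙ))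
  ψ-1-1 f = begin
    θ (proj₁ f) - (θ x + 0#) + 0#  ≈⟨ identityʳ _ ⟩
    θ (proj₁ f) - (θ x + 0#)       ≈⟨ +-congˡ (-‿cong (identityʳ _)) ⟩
    θ (proj₁ f) - θ x              ≈⟨ F.⁻¹-anti-homo-// zF (φ f) ⟨
    - (θ x - θ (proj₁ f))          ≈⟨ -‿cong (θ-f+x (isFixed f)) ⟨
    - θ (proj₁ f + x)              ∎

  -- Turns values of `θ` into values of `ψ`. Starting from `- g`, the odd case has the right sign
  -- already, and the even case is corrected by negating `f`.
  ψ-hits : ∀ (g : M.Carrier) (p : M.Carrier × Parity) → - proj₁ g ≈ θ (unpair p) →
           ∃[ f ] proj₁ (M.ψ φ zF f (proj₂ p) 1ℙ) ≈ proj₁ g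
  ψ-hits g (f , 0ℙ) eq = fixed (Fixed-neg (isFixed f)) , (begin
    proj₁ (M.ψ φ zF (fixed (Fixed-neg (isFixed f))) 0ℙ 1ℙ)
                   ≈⟨ ψ-0-1 (fixed (Fixed-neg (isFixed f))) ⟩
    θ (- proj₁ f)  ≈⟨ θ-neg (isFixed f) ⟩
    - θ (proj₁ f)  ≈⟨ -‿cong eq ⟨
    - (- proj₁ g)  ≈⟨ ⁻¹-involutive _ ⟩
    proj₁ g        ∎)
  ψ-hits g (f , 1ℙ) eq =
    f , trans (ψ-1-1 f) (trans (-‿cong (sym eq)) (⁻¹-involutive _))

  ψ-surjective : M.IsSurjectiveψ φ zF
  ψ-surjective g =
    let p , covered = θ-unpair-covers (fixed (Fixed-neg (isFixed g)))
        k = proj₂ p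
        f , hit = ψ-hits g p covered
    in (f , k , 1ℙ) , λ { {f′ , _} (eq , ≡.refl , ≡.refl) → trans (ψ-cong {f′} {f} k 1ℙ eq) hit }

  model : M.ModelSkewBrace
  model = record
    { y = yF
    ; φ = φ
    ; z = zF
    ; 2y≈0 = trans (+-congˡ (trans (identityʳ y) y≈-y)) (inverseʳ y)
    ; φ-isEndo = record
      { isMonoidHomomorphism = record
        { isMagmaHomomorphism = record
          { isRelHomomorphism = record { cong = θ-cong }
          ; homo = λ f g → θ-+ (proj₁ f) (isFixed g)
          }
        ; ε-homo = θ-0
        }
      ; ⁻¹-homo = λ f → θ-neg (isFixed f)
      }
    ; φz≈φy-2z = trans θθx≈θy-2θx (+-congˡ (-‿cong (+-congˡ (sym (identityʳ _)))))
    ; φφ≈-2φ = λ f → trans (θθ≈-2θ (isFixed f)) (-‿cong (+-congˡ (sym (identityʳ _))))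
    ; ψ-surjective = ψ-surjective
    ; isSkewBrace = record
      { +-isGroup = Add.isGroup
      ; ∘-isGroup = Mul.isGroup
      ; distrib = model-distrib
      }
    }

  iso : A ≅ M.ModelSkewBrace.skewBrace model
  iso = record { ⟦_⟧ = pair ; +-isIso = Add.isIso ; ∘-isIso = Mul.isIso }

-- Orbits as subsets and vertices of the graph.

subset : ∀ {n p} {P : U.Pred (Fin n) p} → U.Decidable P → Subset n
subset P? = tabulate λ i → does (P? i)

∈-subset : ∀ {n p} {P : U.Pred (Fin n) p} (P? : U.Decidable P) {i} → i ∈ subset P? ⇔ P i
∈-subset P? {i} = mk⇔ to from
  where
  to : i ∈ subset P? → _
  to i∈ with P? i | ≡.trans (≡.sym (lookup∘tabulate (λ i → does (P? i)) i)) ([]=⇒lookup i∈)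
  ... | yes p | _ = p
  ... | no _  | ()

  from : _ → i ∈ subset P?
  from p = lookup⇒[]= i _ (≡.trans (lookup∘tabulate _ i) (dec-true (P? i) p))

1<∣p∣ : ∀ {n} {p : Subset n} {i j} → i ∈ p → j ∈ p → i ≢ j → 1 < ∣ p ∣
1<∣p∣ {p = p} {i} {j} i∈p j∈p i≢j = ≡.subst (_< ∣ p ∣) (∣⁅x⁆∣≡1 i) (p⊂q⇒∣p∣<∣q∣
  ( (λ k∈ → ≡.subst (_∈ p) (≡.sym (x∈⁅y⁆⇒x≡y i k∈)) i∈p)
  , j , j∈p , λ j∈ → i≢j (≡.sym (x∈⁅y⁆⇒x≡y i j∈))))

⊆-singleton⇒≯1 : ∀ {n} {p : Subset n} i → (∀ {j} → j ∈ p → j ≡ i) → ¬ 1 < ∣ p ∣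
⊆-singleton⇒≯1 {p = p} i p⊆i = ≤⇒≯ (≡.subst (∣ p ∣ ≤_) (∣⁅x⁆∣≡1 i)
  (p⊆q⇒∣p∣≤∣q∣ λ j∈p → ≡.subst (_∈ ⁅ i ⁆) (≡.sym (p⊆i j∈p)) (x∈⁅x⁆ i)))

module Vertices {c ℓ} (A : SkewBrace c ℓ) (finite : Finite (SkewBrace.setoid A)) where
  open SkewBrace A
  open Action A
  open FiniteSkewBrace A finite
  open Equivalence using () renaming (to to ⇒; from to ⇐)

  -- The orbit of a fixed point is a singleton, too small for a vertex.
  base-¬fixed : ∀ {L} (v : IsVertex A finite L) → ¬ Fixed (proj₁ (proj₁ v))
  base-¬fixed {L} ((b , orbit) , 1<∣L∣) fb = ⊆-singleton⇒≯1 (to b)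
    (λ {i} i∈L → let a , p = ⇒ (orbit i) i∈L in
      ≡.trans (≡.sym (to-from i)) (to-cong (trans p (fb a))))
    1<∣L∣

  orbit : Carrier → Subset size
  orbit b = subset λ i → orbit? b (from i)

  ∈-orbit : ∀ b j → j ∈ orbit b ⇔ (∃[ a ] from j ≈ act a b)
  ∈-orbit b j = ∈-subset λ i → orbit? b (from i)

  to-c∈orbit : ∀ {b c} → ∃[ a ] c ≈ act a b → to c ∈ orbit b
  to-c∈orbit {b} (a , p) = ⇐ (∈-orbit b _) (a , trans (from-to _) p)

  -- Finiteness turns `¬ Fixed b` into an explicit element moving `b`; then `b` and its image are
  -- two points of the orbit.
  orbit-isVertex : ∀ {b} → ¬ Fixed b → IsVertex A finite (orbit b)
  orbit-isVertex {b} ¬fb with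
    Fin.¬∀⟶∃¬ size (λ i → act (from i) b ≈ b) (λ i → act (from i) b ≟ b)
      (λ f → ¬fb λ a → trans (act-cong (sym (from-to a)) refl) (f (to a)))
  ... | i , moved = (b , ∈-orbit b) ,
    1<∣p∣ (to-c∈orbit (1# , sym (act-1 b))) (to-c∈orbit (from i , refl))
      (λ eq → moved (sym (to-injective eq)))

  oneVertex⇒singleOrbit : HasExactlyOneVertex (Λ A finite) → ∃[ b ] SingleOrbit b
  oneVertex⇒singleOrbit ((L , v@((b , orbit-b) , _)) , unique) = b , record
    { ¬fixed = base-¬fixed v
    ; transitive = λ c ¬fc →
        let L≡orbit-c = unique (orbit c , orbit-isVertex ¬fc)
            a , p = ⇒ (orbit-b (to c)) (≡.subst (to c ∈_) (≡.sym L≡orbit-c)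
                      (to-c∈orbit (1# , sym (act-1 c))))
        in a , trans (sym (from-to c)) p
    }

  singleOrbit⇒oneVertex : ∀ {b} → SingleOrbit b → HasExactlyOneVertex (Λ A finite)
  singleOrbit⇒oneVertex {b} single = (orbit b , orbit-isVertex ¬fixed) , unique
    where
    open SingleOrbit single
    unique : ∀ (w : Σ (Subset size) (IsVertex A finite)) → orbit b ≡ proj₁ w
    unique (L , w@((c , orbit-c) , _)) = ⊆-antisym
      -- As `c ≈ act a b`, transporters from `b` and from `c` differ by right multiplication by `a`.
      (λ {i} i∈ → let d , q = ⇒ (∈-orbit b i) i∈ in
        ⇐ (orbit-c i) (d ∘ a ⁻¹ ,
          trans q (trans (act-cong refl (sym (act-⁻¹ (sym p)))) (sym (act-∘ d (a ⁻¹) c)))))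
      (λ {i} i∈ → let d , q = ⇒ (orbit-c i) i∈ in
        ⇐ (∈-orbit b i) (d ∘ a , trans q (trans (act-cong refl p) (sym (act-∘ d a b)))))
      where
      moved = transitive c (base-¬fixed w)
      a = proj₁ moved
      p = proj₂ moved

-- The single nontrivial orbit of a model.

module ModelOrbit {c ℓ} (F : AbelianGroup c ℓ) (B : Model.ModelSkewBrace F) where
  open Model F hiding (_≈_; setoid)
  open AbelianGroup F
    using (_≈_; setoid; refl; sym; trans; assoc; identityˡ; identityʳ; inverseʳ)
    renaming (∙-congˡ to +-congˡ; ∙-congʳ to +-congʳ; ⁻¹-cong to -‿cong)
  open AbelianGroupProperties F using (⁻¹-involutive; ⁻¹-∙-comm; ε⁻¹≈ε)
  open ModelSkewBrace B
  open IsGroupHomomorphism φ-isEndo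
    using () renaming (ε-homo to φ-0; ⁻¹-homo to φ-neg)
  open ≈-Reasoning setoid

  private
    module S = SkewBrace skewBrace
    module SA = Action skewBrace

  signed-homo : ∀ k f g → signed k (f + g) ≈ signed k f + signed k g
  signed-homo 0ℙ f g = refl
  signed-homo 1ℙ f g = sym (⁻¹-∙-comm f g)

  signed-involutive : ∀ k f → signed k (signed k f) ≈ f
  signed-involutive 0ℙ f = refl
  signed-involutive 1ℙ f = ⁻¹-involutive f

  -- Checked after adding `(f , k)`: the sign is applied twice and cancels, and the `y` terms on
  -- both sides agree.
  act-model : ∀ f k g l → S.act (f , k) (g , l) S.≈ (g + signed k (ψ φ z f k l) , l)
  act-model f k g l = SA.+-cancelˡ (f , k) _ _ (SA.trans
    (SA.sym (SA.a∘b≈a+act (f , k) (g , l)))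
    (+-congʳ (sym (begin
      f + signed k (g + signed k u)           ≈⟨ +-congˡ (signed-homo k g _) ⟩
      f + (signed k g + signed k (signed k u)) ≈⟨ +-congˡ (+-congˡ (signed-involutive k u)) ⟩
      f + (signed k g + u)                    ≈⟨ assoc _ _ _ ⟨
      f + signed k g + u                      ∎)) , ≡.refl))
    where u = ψ φ z f k l

  fixed-0ℙ : ∀ {p} → proj₂ p ≡ 0ℙ → SA.Fixed p
  fixed-0ℙ {g , 0ℙ} ≡.refl (f , k) = SA.trans (act-model f k g 0ℙ)
    (trans (+-congˡ (signed-0 k)) (identityʳ g) , ≡.refl)
    where
    signed-0 : ∀ k → signed k 0# ≈ 0#
    signed-0 0ℙ = refl
    signed-0 1ℙ = ε⁻¹≈ε

  ψ-0-1 : ∀ f → ψ φ z f 0ℙ 1ℙ ≈ φ f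
  ψ-0-1 f = trans (identityʳ _) (trans (+-congˡ ε⁻¹≈ε) (identityʳ _))

  -- Surjectivity of ψ at -d: the value φ(f) = -d is turned into d by f ↦ -f, and the
  -- value φ(f) - z = -d by the sign of the action.
  ψ-covers : ∀ d → ∃[ f ] ∃[ k ] signed k (ψ φ z f k 1ℙ) ≈ d
  ψ-covers d with ψ-surjective (- d)
  ... | (f , k , l) , hits = cases k l (hits (refl , ≡.refl , ≡.refl))
    where
    cases : ∀ k l → ψ φ z f k l ≈ - d → ∃[ f ] ∃[ k ] signed k (ψ φ z f k 1ℙ) ≈ d
    -- Here `ψ` takes the value `0#`, so `d` is zero and is reached from `φ 0#`.
    cases k 0ℙ p = 0# , 0ℙ , (begin
      ψ φ z 0# 0ℙ 1ℙ  ≈⟨ ψ-0-1 0# ⟩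
      φ 0#            ≈⟨ φ-0 ⟩
      0#              ≈⟨ ε⁻¹≈ε ⟨
      - 0#            ≈⟨ -‿cong p ⟩
      - - d           ≈⟨ ⁻¹-involutive d ⟩
      d               ∎)
    cases 0ℙ 1ℙ p = - f , 0ℙ , (begin
      ψ φ z (- f) 0ℙ 1ℙ  ≈⟨ ψ-0-1 (- f) ⟩
      φ (- f)            ≈⟨ φ-neg f ⟩
      - φ f              ≈⟨ -‿cong (ψ-0-1 f) ⟨
      - ψ φ z f 0ℙ 1ℙ    ≈⟨ -‿cong p ⟩
      - - d              ≈⟨ ⁻¹-involutive d ⟩
      d                  ∎)
    cases 1ℙ 1ℙ p = f , 1ℙ , trans (-‿cong p) (⁻¹-involutive d)

  transitive-1ℙ : ∀ f g → ∃[ a ] (g , 1ℙ) S.≈ S.act a (f , 1ℙ)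
  transitive-1ℙ f g =
    let h , k , p = ψ-covers (- f + g) in
    (h , k) , SA.sym (SA.trans (act-model h k f 1ℙ)
      (trans (+-congˡ p) (trans (sym (assoc _ _ _)) (trans (+-congʳ (inverseʳ f)) (identityˡ g))) , ≡.refl))

  -- If `(0# , 1ℙ)` were fixed, transitivity on the odd layer would make every `f` zero.
  model-singleOrbit : ¬ (∀ f → f ≈ 0#) → SA.SingleOrbit (0# , 1ℙ)
  model-singleOrbit F≉0 = record
    { ¬fixed = λ fixed → F≉0 λ f →
        let a , p , _ = transitive-1ℙ 0# f in trans p (proj₁ (fixed a))
    ; transitive = λ
        { (g , 0ℙ) ¬f → contradiction (fixed-0ℙ ≡.refl) ¬f
        ; (g , 1ℙ) _ → transitive-1ℙ 0# g
        }
    }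

-- Invariance of the single-orbit property under isomorphism.

module _ {c₁ ℓ₁ c₂ ℓ₂} {A : SkewBrace c₁ ℓ₁} {B : SkewBrace c₂ ℓ₂} (iso : A ≅ B) where
  private
    module A where
      open SkewBrace A public
      open Action A public
    module B where
      open SkewBrace B public
      open Action B public
  open _≅_ iso
  private
    module + = IsGroupIsomorphism +-isIso
    module ∘ = IsGroupIsomorphism ∘-isIso

  act-homo : ∀ a b → ⟦ A.act a b ⟧ B.≈ B.act ⟦ a ⟧ ⟦ b ⟧
  act-homo a b = B.trans (+.∙-homo _ _) (B.+-cong (+.⁻¹-homo a) (∘.∙-homo a b))

  Fixed-⟦⟧⁺ : ∀ {b} → A.Fixed b → B.Fixed ⟦ b ⟧
  Fixed-⟦⟧⁺ {b} fb a′ = let a , p = +.surjective a′ in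
    B.trans (B.act-cong (B.sym (p A.refl)) B.refl)
      (B.trans (B.sym (act-homo a b)) (+.⟦⟧-cong (fb a)))

  Fixed-⟦⟧⁻ : ∀ {b} → B.Fixed ⟦ b ⟧ → A.Fixed b
  Fixed-⟦⟧⁻ {b} fb a = +.injective (B.trans (act-homo a b) (fb ⟦ a ⟧))

  singleOrbit-⟦⟧⁻ : ∀ {b′} → B.SingleOrbit b′ → ∃[ b ] A.SingleOrbit b
  singleOrbit-⟦⟧⁻ {b′} single = b , record
    { ¬fixed = λ fb → ¬fixed (B.Fixed-resp (⟦b⟧≈b′ A.refl) (Fixed-⟦⟧⁺ fb))
    ; transitive = λ c ¬fc →
        let a′ , p = transitive ⟦ c ⟧ (¬fc ∘′ Fixed-⟦⟧⁻)
            a , q = +.surjective a′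
        in a , +.injective (B.trans p (B.trans
             (B.act-cong (B.sym (q A.refl)) (B.sym (⟦b⟧≈b′ A.refl))) (B.sym (act-homo a b))))
    }
    where
    open B.SingleOrbit single
    b = proj₁ (+.surjective b′)
    ⟦b⟧≈b′ = proj₂ (+.surjective b′)

mainTheorem16 : ∀ {c ℓ} (A : SkewBrace c ℓ) (finite : Finite (SkewBrace.setoid A)) →
    HasExactlyOneVertex (Λ A finite) ⇔
    (Σ (AbelianGroup c ℓ) λ F →
    Finite (AbelianGroup.setoid F) ×
    (¬ (∀ f → AbelianGroup._≈_ F f (AbelianGroup.ε F))) ×
    (Σ (Model.ModelSkewBrace F) λ B → A ≅ Model.ModelSkewBrace.skewBrace B))
mainTheorem16 A finite = mk⇔
  (λ one →
    let _ , single = oneVertex⇒singleOrbit one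
        open Reconstruct A single (FiniteSkewBrace.fixed? A finite)
               (FiniteSkewBrace.Index.index-two A finite single)
    in F , F-finite finite , F-nontrivial , model , iso)
  (λ (F , _ , F≉0 , B , iso) →
    singleOrbit⇒oneVertex (proj₂ (singleOrbit-⟦⟧⁻ iso (ModelOrbit.model-singleOrbit F B F≉0))))
  where open Vertices A finite
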